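{- Let $\mathcal{Z}$ be a set of positive integers. For every proper subset $\mathcal{Y}\subsetneq\mathcal{Z}$ there exists a triangular sum with cross terms that represents every element of $\mathcal{Y}$ but does not represent every element of $\mathcal{Z}$.
   Context: $T_x=\frac{x(x+1)}{2}$ and $B_{xy}=\frac14(2xy+x+y)$ for integers $x,y$. Let $Q(X)=\sum_{i=1}^k a_iX_i^2+\sum_{1\leq i<j\leq k}4c_{ij}X_iX_j$ be a positive definite quadratic form with integers $a_i,c_{ij}$. The triangular sum with cross terms attached to $Q$ is $f_Q(x)=\sum_{i=1}^k a_iT_{x_i}+\sum_{i<j}4c_{ij}B_{x_ix_j}+C$, where $C$ is the unique integer such that $f_Q$ is normalized totally positive, i.e. $f_Q(\mathbb{Z}^k)$ consists of nonnegative integers and contains $0$. A polynomial $f$ represents $n$ if $f(x)=n$ for some $x\in\mathbb{Z}^k$. -}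

module Defs where

open import Data.Nat as ℕ using (ℕ; zero; suc)
open import Data.Integer using (ℤ; +_; _+_; _*_; _<_; _≤_)
open import Data.Fin using (Fin; zero; suc; _<?_)
open import Data.Bool using (if_then_else_)
open import Data.Product using (Σ; ∃; _×_)
open import Relation.Nullary using (¬_)
open import Relation.Nullary.Decidable using (⌊_⌋)
open import Relation.Binary.PropositionalEquality using (_≡_)

sumFin : (k : ℕ) → (Fin k → ℤ) → ℤ
sumFin zero    f = + 0
sumFin (suc k) f = f zero + sumFin k (λ i → f (suc i))

sumPairs : (k : ℕ) → (Fin k → Fin k → ℤ) → ℤ
sumPairs k g = sumFin k (λ i → sumFin k (λ j → if ⌊ i <? j ⌋ then g i j else + 0))

Q : (k : ℕ) → (Fin k → ℤ) → (Fin k → Fin k → ℤ) → (Fin k → ℤ) → ℤ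
Q k a c x = sumFin k (λ i → a i * (x i * x i))
          + sumPairs k (λ i j → + 4 * c i j * (x i * x j))

PosDef : (k : ℕ) → (Fin k → ℤ) → (Fin k → Fin k → ℤ) → Set
PosDef k a c = (x : Fin k → ℤ) → ¬ ((i : Fin k) → x i ≡ + 0) → + 0 < Q k a c x

-- 2 T_x = x(x+1),  2 · (4 B_xy) = 2(2xy + x + y)
twoT : ℤ → ℤ
twoT x = x * (x + + 1)

twoFourB : ℤ → ℤ → ℤ
twoFourB x y = + 2 * (+ 2 * (x * y) + x + y)

-- twiceF k a c C x = 2 · f(x), where
-- f(x) = Σ a_i T_{x_i} + Σ_{i<j} 4 c_ij B_{x_i x_j} + C   (always an integer)
twiceF : (k : ℕ) → (Fin k → ℤ) → (Fin k → Fin k → ℤ) → ℤ → (Fin k → ℤ) → ℤ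
twiceF k a c C x = sumFin k (λ i → a i * twoT (x i))
                 + sumPairs k (λ i j → c i j * twoFourB (x i) (x j))
                 + + 2 * C

NormalizedTotallyPositive : (k : ℕ) → (Fin k → ℤ) → (Fin k → Fin k → ℤ) → ℤ → Set
NormalizedTotallyPositive k a c C =
  ((x : Fin k → ℤ) → + 0 ≤ twiceF k a c C x) × ∃ (λ x → twiceF k a c C x ≡ + 0)

Represents : (k : ℕ) → (Fin k → ℤ) → (Fin k → Fin k → ℤ) → ℤ → ℕ → Set
Represents k a c C n = ∃ (λ (x : Fin k → ℤ) → twiceF k a c C x ≡ + 2 * + n)

-- A triangular sum with cross terms: data (k, a, c, C) with 1 ≤ k, Q positive
-- definite, and C the (unique) constant making f normalized totally positive.
record TriSum : Set where
  field
    k   : ℕ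
    k≥1 : 1 ℕ.≤ k
    a   : Fin k → ℤ
    c   : Fin k → Fin k → ℤ
    C   : ℤ
    posDef : PosDef k a c
    normalized : NormalizedTotallyPositive k a c C

TriSumRepresents : TriSum → ℕ → Set
TriSumRepresents f n = Represents (TriSum.k f) (TriSum.a f) (TriSum.c f) (TriSum.C f) n

{-# OPTIONS --safe #-}

-- For each z = m + 1 > 0 there is a triangular sum representing exactly the
-- nonnegative integers other than z. Put N = z + 1 and take the variables x₀, xⱼ with
--   f = (N + 1) T_{x₀} + Σⱼ (N T_{xⱼ} + γⱼ (x₀ + xⱼ + 1)²),
-- where γⱼ = 1 for m of the j ("leaves") and γⱼ = 0 for eight further ones; expanding the
-- squares shows that f is a triangular sum with cross terms c₀ⱼ = γⱼ.
-- A value below N needs all T to vanish, so x₀, xⱼ ∈ {0, -1}, and is at most m. Conversely the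
-- leaves produce 0, …, m, with x₀ = 1 they produce z + N, and the eight remaining
-- variables add any multiple of N by Lagrange's theorem, since T_a + T_{a-1} = a².

module Submission where

open import Defs
open import Data.Bool using (true; false; if_then_else_)
open import Data.Fin as Fin using (Fin; zero; suc; toℕ; fromℕ<; splitAt; join; _↑ˡ_; _↑ʳ_)
import Data.Fin.Properties as Finₚ
open import Data.Integer as ℤ using (ℤ; +_; -[1+_]; _+_; _*_; _-_; -_; ∣_∣; +≤+; +<+)
open import Data.Integer.DivMod using (_%ℕ_; _/ℕ_; n%ℕd<d; a≡a%ℕn+[a/ℕn]*n)
open import Data.Integer.Divisibility.Signed using (_∣_; divides; ∣⇒∣ᵤ)
import Data.Integer.Properties as ℤₚ
open import Data.Integer.Tactic.RingSolver using (solve-∀)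
open import Data.List using ([]; _∷_)
open import Data.List.Relation.Unary.All using (All; []; _∷_)
open import Data.Nat as ℕ using (ℕ; zero; suc; _<_)
import Data.Nat.DivMod as ℕ
import Data.Nat.Divisibility as ℕ
open import Data.Nat.Induction using (<-rec)
open import Data.Nat.ListAction using (product)
open import Data.Nat.Primality using (Prime; prime⇒nonZero; prime⇒nonTrivial; prime⇒irreducible; euclidsLemma)
open import Data.Nat.Primality.Factorisation using (factorise; module PrimeFactorisation)
import Data.Nat.Properties as ℕₚ
open import Data.Nat.Tactic.RingSolver using () renaming (solve-∀ to ℕ-solve-∀)
open import Data.Product using (Σ; ∃; ∃₂; _×_; _,_)
open import Data.Sum using (_⊎_; inj₁; inj₂; [_,_]′)
open import Data.Vec.Functional using (replicate; _++_) renaming (_∷_ to _∷ᵛ_; [] to []ᵛ)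
open import Data.Vec.Functional.Properties using (lookup-++ˡ; lookup-++ʳ)
open import Function using (_∘_; case_of_; id)
open import Relation.Binary.Definitions using (tri<; tri≈; tri>)
open import Relation.Binary.PropositionalEquality using (_≡_; _≢_; refl; sym; trans; cong; cong₂; subst; subst₂; module ≡-Reasoning)
open import Relation.Nullary using (¬_; yes; no; contradiction)
open import Relation.Nullary.Decidable using (⌊_⌋)

-- Lagrange's four-square theorem

FourSquares : ℤ → Set
FourSquares n = ∃₂ λ a b → ∃₂ λ c d → n ≡ a * a + b * b + c * c + d * d

0≤+ : ∀ {i j} → + 0 ℤ.≤ i → + 0 ℤ.≤ j → + 0 ℤ.≤ i + j
0≤+ = ℤₚ.+-mono-≤

0≤* : ∀ {i j} → + 0 ℤ.≤ i → + 0 ℤ.≤ j → + 0 ℤ.≤ i * j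
0≤* {+ m} {+ n} _ _ = subst (+ 0 ℤ.≤_) (ℤₚ.pos-* m n) (+≤+ ℕ.z≤n)

i<j⇒0<j-i : ∀ {i j} → i ℤ.< j → + 0 ℤ.< j - i
i<j⇒0<j-i {i} {j} i<j = subst (ℤ._< j - i) (ℤₚ.+-inverseʳ i) (ℤₚ.+-monoˡ-< (- i) i<j)

0≤i*i : ∀ i → + 0 ℤ.≤ i * i
0≤i*i (+ n)    = 0≤* {+ n} {+ n} (+≤+ ℕ.z≤n) (+≤+ ℕ.z≤n)
0≤i*i -[1+ n ] = +≤+ ℕ.z≤n

i*i≡0⇒i≡0 : ∀ i → i * i ≡ + 0 → i ≡ + 0
i*i≡0⇒i≡0 i eq = [ id , id ]′ (ℤₚ.i*j≡0⇒i≡0∨j≡0 i eq)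

i+j≡0⇒i≡0 : ∀ {i j} → + 0 ℤ.≤ i → + 0 ℤ.≤ j → i + j ≡ + 0 → i ≡ + 0
i+j≡0⇒i≡0 {i} {j} 0≤i 0≤j eq = ℤₚ.≤-antisym
  (subst₂ ℤ._≤_ (ℤₚ.+-identityʳ i) eq (ℤₚ.+-monoʳ-≤ i 0≤j)) 0≤i

i+j≡0⇒j≡0 : ∀ {i j} → + 0 ℤ.≤ i → + 0 ℤ.≤ j → i + j ≡ + 0 → j ≡ + 0
i+j≡0⇒j≡0 {i} {j} 0≤i 0≤j eq = i+j≡0⇒i≡0 0≤j 0≤i (trans (ℤₚ.+-comm j i) eq)

sum₄≡0⇒≡0 : ∀ {a b c d} → + 0 ℤ.≤ a → + 0 ℤ.≤ b → + 0 ℤ.≤ c → + 0 ℤ.≤ d →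
  a + b + c + d ≡ + 0 → a ≡ + 0 × b ≡ + 0 × c ≡ + 0 × d ≡ + 0
sum₄≡0⇒≡0 0≤a 0≤b 0≤c 0≤d eq = i+j≡0⇒i≡0 0≤a 0≤b ab , i+j≡0⇒j≡0 0≤a 0≤b ab ,
  i+j≡0⇒j≡0 (0≤+ 0≤a 0≤b) 0≤c abc , i+j≡0⇒j≡0 (0≤+ (0≤+ 0≤a 0≤b) 0≤c) 0≤d eq
  where
  abc = i+j≡0⇒i≡0 (0≤+ (0≤+ 0≤a 0≤b) 0≤c) 0≤d eq
  ab  = i+j≡0⇒i≡0 (0≤+ 0≤a 0≤b) 0≤c abc

euler-four-square-identity : ∀ a b c d x y z w →
  (a * a + b * b + c * c + d * d) * (x * x + y * y + z * z + w * w) ≡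
  (a * x + b * y + c * z + d * w) * (a * x + b * y + c * z + d * w)
  + (a * y - b * x + c * w - d * z) * (a * y - b * x + c * w - d * z)
  + (a * z - c * x + d * y - b * w) * (a * z - c * x + d * y - b * w)
  + (a * w - d * x + b * z - c * y) * (a * w - d * x + b * z - c * y)
euler-four-square-identity = solve-∀

FourSquares-* : ∀ {m n} → FourSquares m → FourSquares n → FourSquares (m * n)
FourSquares-* (a , b , c , d , refl) (x , y , z , w , refl) =
  a * x + b * y + c * z + d * w , a * y - b * x + c * w - d * z ,
  a * z - c * x + d * y - b * w , a * w - d * x + b * z - c * y ,
  euler-four-square-identity a b c d x y z w

-- Symmetric residues and the descent on a multiple of a prime.

symmetricResidue : ∀ m .{{_ : ℕ.NonZero m}} x →
  ∃₂ λ y q → x ≡ y + q * + m × + 0 ℤ.≤ + m - + 2 * y × + 0 ℤ.< + m + + 2 * y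
symmetricResidue m x with x %ℕ m | x /ℕ m | a≡a%ℕn+[a/ℕn]*n x m | n%ℕd<d x m
... | r | q | eq | r<m with 2 ℕ.* r ℕ.≤? m
-- The remainder is kept up to and including m/2 and lowered by m beyond it. A tie thus goes to
-- +m/2, which makes the upper bound weak and the lower one strict.
... | yes 2r≤m = + r , q , eq ,
  ℤₚ.i≤j⇒0≤j-i (subst (ℤ._≤ + m) (ℤₚ.pos-* 2 r) (+≤+ 2r≤m)) ,
  subst (λ t → + 0 ℤ.< + m + t) (ℤₚ.pos-* 2 r) (+<+ (ℕₚ.<-≤-trans (ℕₚ.≤-<-trans ℕ.z≤n r<m) (ℕₚ.m≤m+n m _)))
... | no 2r≰m = + r - + m , q + + 1 , trans eq (shift (+ r) q (+ m)) ,
  subst (+ 0 ℤ.≤_) (sym (upper (+ r) (+ m)))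
    (0≤+ (+≤+ (ℕ.z≤n {m})) (0≤* (+≤+ (ℕ.z≤n {2})) (ℤₚ.i≤j⇒0≤j-i (+≤+ (ℕₚ.<⇒≤ r<m))))) ,
  subst (+ 0 ℤ.<_) (sym (lower (+ r) (+ m)))
    (i<j⇒0<j-i (subst (+ m ℤ.<_) (ℤₚ.pos-* 2 r) (+<+ (ℕₚ.≰⇒> 2r≰m))))
  where
  shift : ∀ r q m → r + q * m ≡ (r - m) + (q + + 1) * m
  shift = solve-∀
  upper : ∀ r m → m - + 2 * (r - m) ≡ m + + 2 * (m - r)
  upper = solve-∀
  lower : ∀ r m → m + + 2 * (r - m) ≡ + 2 * r - m
  lower = solve-∀

∣-between : ∀ {m n} → 0 < n → n < m → ¬ m ℕ.∣ n
∣-between {n = suc _} _ n<m m∣n = ℕₚ.<⇒≱ n<m (ℕ.∣⇒≤ m∣n)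

1<m<p⇒m∤p : ∀ {m p} → Prime p → 1 < m → m < p → ¬ + m ∣ + p
1<m<p⇒m∤p pp 1<m m<p m∣p with prime⇒irreducible pp (∣⇒∣ᵤ m∣p)
... | inj₁ refl = ℕₚ.<-irrefl refl 1<m
... | inj₂ refl = ℕₚ.<-irrefl refl m<p

-- The descent step: if mp = Σ(yᵢ + qᵢm)² with |yᵢ| ≤ m/2, then Σyᵢ² = mr with 0 < r < m, and
-- rp is again a sum of four squares.
module _ (m p r y₁ y₂ y₃ y₄ q₁ q₂ q₃ q₄ : ℤ) where
  private
    S = y₁ * q₁ + y₂ * q₂ + y₃ * q₃ + y₄ * q₄
    A = y₁ * y₁ + y₂ * y₂ + y₃ * y₃ + y₄ * y₄
    D = q₁ * q₁ + q₂ * q₂ + q₃ * q₃ + q₄ * q₄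
    u = y₁ * q₂ - y₂ * q₁ + y₃ * q₄ - y₄ * q₃
    v = y₁ * q₃ - y₃ * q₁ + y₄ * q₂ - y₂ * q₄
    w = y₁ * q₄ - y₄ * q₁ + y₂ * q₃ - y₃ * q₂

  -- Multiplying out, rp = r² + 2rS + AD. Euler's identity splits AD into four squares of which the
  -- first is S², and this one completes r² + 2rS to (r + S)².
  FourSquares-quotient : p ≡ r + + 2 * S + m * D → m * r ≡ A → FourSquares (r * p)
  FourSquares-quotient p≡ mr≡A = r + S , u , v , w , (begin
    r * p                                   ≡⟨ cong (r *_) p≡ ⟩
    r * (r + + 2 * S + m * D)               ≡⟨ expand r S m D ⟩
    r * r + + 2 * (r * S) + (m * r) * D     ≡⟨ cong (λ t → r * r + + 2 * (r * S) + t * D) mr≡A ⟩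
    r * r + + 2 * (r * S) + A * D           ≡⟨ cong (_+_ (r * r + + 2 * (r * S))) (euler-four-square-identity y₁ y₂ y₃ y₄ q₁ q₂ q₃ q₄) ⟩
    r * r + + 2 * (r * S) + (S * S + u * u + v * v + w * w) ≡⟨ complete r S (u * u) (v * v) (w * w) ⟩
    (r + S) * (r + S) + u * u + v * v + w * w           ∎)
    where
    open ≡-Reasoning
    expand : ∀ r S m D → r * (r + + 2 * S + m * D) ≡ r * r + + 2 * (r * S) + (m * r) * D
    expand = solve-∀
    complete : ∀ r S a b c → r * r + + 2 * (r * S) + (S * S + a + b + c) ≡ (r + S) * (r + S) + a + b + c
    complete = solve-∀

module _ (m p y₁ y₂ y₃ y₄ q₁ q₂ q₃ q₄ : ℤ) where
  private
    S = y₁ * q₁ + y₂ * q₂ + y₃ * q₃ + y₄ * q₄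
    A = y₁ * y₁ + y₂ * y₂ + y₃ * y₃ + y₄ * y₄
    D = q₁ * q₁ + q₂ * q₂ + q₃ * q₃ + q₄ * q₄

  -- Every term of the expansion other than the yᵢ² carries a factor m, so the quotient r is an
  -- explicit polynomial and no division takes place.
  sum-squares-mod : m * p ≡ (y₁ + q₁ * m) * (y₁ + q₁ * m) + (y₂ + q₂ * m) * (y₂ + q₂ * m)
                          + (y₃ + q₃ * m) * (y₃ + q₃ * m) + (y₄ + q₄ * m) * (y₄ + q₄ * m) →
    m * (p - + 2 * S - m * D) ≡ A
  sum-squares-mod eq = begin
    m * (p - + 2 * S - m * D)      ≡⟨ expand m p S D ⟩
    m * p - m * (+ 2 * S + m * D)  ≡⟨ cong (_- m * (+ 2 * S + m * D)) eq ⟩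
    _                              ≡⟨ collect m y₁ y₂ y₃ y₄ q₁ q₂ q₃ q₄ ⟩
    A                              ∎
    where
    open ≡-Reasoning
    expand : ∀ m p S D → m * (p - + 2 * S - m * D) ≡ m * p - m * (+ 2 * S + m * D)
    expand = solve-∀
    collect : ∀ m y₁ y₂ y₃ y₄ q₁ q₂ q₃ q₄ →
      (y₁ + q₁ * m) * (y₁ + q₁ * m) + (y₂ + q₂ * m) * (y₂ + q₂ * m)
      + (y₃ + q₃ * m) * (y₃ + q₃ * m) + (y₄ + q₄ * m) * (y₄ + q₄ * m)
      - m * (+ 2 * (y₁ * q₁ + y₂ * q₂ + y₃ * q₃ + y₄ * q₄) + m * (q₁ * q₁ + q₂ * q₂ + q₃ * q₃ + q₄ * q₄))
      ≡ y₁ * y₁ + y₂ * y₂ + y₃ * y₃ + y₄ * y₄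
    collect = solve-∀

-- Since the lower bound is strict, m + 2y cannot be the factor that vanishes.
residue-extremal : ∀ {m y} → + 0 ℤ.< m + + 2 * y → (m - + 2 * y) * (m + + 2 * y) ≡ + 0 → m ≡ + 2 * y
residue-extremal {m} {y} 0<m+2y eq with ℤₚ.i*j≡0⇒i≡0∨j≡0 (m - + 2 * y) eq
... | inj₁ z = ℤₚ.i-j≡0⇒i≡j m (+ 2 * y) z
... | inj₂ z = contradiction (sym z) (ℤₚ.<⇒≢ 0<m+2y)

0≤i*j⇒0≤j : ∀ i j .{{_ : ℤ.Positive i}} → + 0 ℤ.≤ i * j → + 0 ℤ.≤ j
0≤i*j⇒0≤j i j 0≤ij = ℤₚ.*-cancelˡ-≤-pos (+ 0) j i (subst (ℤ._≤ i * j) (sym (ℤₚ.*-zeroʳ i)) 0≤ij)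

module _ (m p r y₁ y₂ y₃ y₄ q₁ q₂ q₃ q₄ : ℤ) .{{_ : ℤ.Positive m}}
  (p≡ : p ≡ r + + 2 * (y₁ * q₁ + y₂ * q₂ + y₃ * q₃ + y₄ * q₄) + m * (q₁ * q₁ + q₂ * q₂ + q₃ * q₃ + q₄ * q₄))
  (mr≡ : m * r ≡ y₁ * y₁ + y₂ * y₂ + y₃ * y₃ + y₄ * y₄) where

  0≤quotient : + 0 ℤ.≤ r
  0≤quotient = 0≤i*j⇒0≤j m r (subst (+ 0 ℤ.≤_) (sym mr≡)
    (0≤+ (0≤+ (0≤+ (0≤i*i y₁) (0≤i*i y₂)) (0≤i*i y₃)) (0≤i*i y₄)))

  -- A vanishing sum of squares makes every residue zero, hence also the cross term, and p = mD is
  -- left.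
  quotient≡0⇒∣ : r ≡ + 0 → m ∣ p
  quotient≡0⇒∣ r≡0 with sum₄≡0⇒≡0 (0≤i*i y₁) (0≤i*i y₂) (0≤i*i y₃) (0≤i*i y₄)
                 (trans (sym mr≡) (trans (cong (m *_) r≡0) (ℤₚ.*-zeroʳ m)))
  ... | z₁ , z₂ , z₃ , z₄ = divides D (trans p≡ (trans (cong₂ (λ a b → a + + 2 * b + m * D) r≡0 S≡0)
      (trans (ℤₚ.+-identityˡ (m * D)) (ℤₚ.*-comm m D))))
    where
    D = q₁ * q₁ + q₂ * q₂ + q₃ * q₃ + q₄ * q₄
    S≡0 : y₁ * q₁ + y₂ * q₂ + y₃ * q₃ + y₄ * q₄ ≡ + 0
    S≡0 = cong₂ _+_ (cong₂ _+_ (cong₂ _+_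
      (cong (_* q₁) (i*i≡0⇒i≡0 y₁ z₁)) (cong (_* q₂) (i*i≡0⇒i≡0 y₂ z₂)))
      (cong (_* q₃) (i*i≡0⇒i≡0 y₃ z₃))) (cong (_* q₄) (i*i≡0⇒i≡0 y₄ z₄))

  module _
    (u₁ : + 0 ℤ.≤ m - + 2 * y₁) (u₂ : + 0 ℤ.≤ m - + 2 * y₂)
    (u₃ : + 0 ℤ.≤ m - + 2 * y₃) (u₄ : + 0 ℤ.≤ m - + 2 * y₄)
    (l₁ : + 0 ℤ.< m + + 2 * y₁) (l₂ : + 0 ℤ.< m + + 2 * y₂)
    (l₃ : + 0 ℤ.< m + + 2 * y₃) (l₄ : + 0 ℤ.< m + + 2 * y₄) where

    private
      -- As m² - 4y² this measures the distance of y from ±m/2. It is nonnegative on symmetric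
      -- residues and sums to 4m(m - r), so one identity yields both r ≤ m and the analysis of
      -- equality.
      G : ℤ → ℤ
      G y = (m - + 2 * y) * (m + + 2 * y)

      0≤G : ∀ y → + 0 ℤ.≤ m - + 2 * y → + 0 ℤ.< m + + 2 * y → + 0 ℤ.≤ G y
      0≤G y u l = 0≤* u (ℤₚ.<⇒≤ l)

      ΣG≡ : G y₁ + G y₂ + G y₃ + G y₄ ≡ + 4 * (m * (m - r))
      ΣG≡ = trans (expand m y₁ y₂ y₃ y₄)
        (trans (cong (λ t → + 4 * (m * m) - + 4 * t) (sym mr≡)) (factor m r))
        where
        expand : ∀ m a b c d →
          (m - + 2 * a) * (m + + 2 * a) + (m - + 2 * b) * (m + + 2 * b)
          + (m - + 2 * c) * (m + + 2 * c) + (m - + 2 * d) * (m + + 2 * d)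
          ≡ + 4 * (m * m) - + 4 * (a * a + b * b + c * c + d * d)
        expand = solve-∀
        factor : ∀ m r → + 4 * (m * m) - + 4 * (m * r) ≡ + 4 * (m * (m - r))
        factor = solve-∀

    quotient≤ : r ℤ.≤ m
    quotient≤ = ℤₚ.0≤i-j⇒j≤i (0≤i*j⇒0≤j m (m - r) (0≤i*j⇒0≤j (+ 4) (m * (m - r))
      (subst (+ 0 ℤ.≤_) ΣG≡
        (0≤+ (0≤+ (0≤+ (0≤G y₁ u₁ l₁) (0≤G y₂ u₂ l₂)) (0≤G y₃ u₃ l₃)) (0≤G y₄ u₄ l₄)))))

    -- If r = m, every residue is m/2, so that m also divides the cross term 2 Σ yᵢqᵢ.
    quotient≡⇒∣ : r ≡ m → m ∣ p
    quotient≡⇒∣ r≡m with sum₄≡0⇒≡0 (0≤G y₁ u₁ l₁) (0≤G y₂ u₂ l₂) (0≤G y₃ u₃ l₃) (0≤G y₄ u₄ l₄)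
                   (trans ΣG≡ (cong (+ 4 *_) (trans (cong (m *_) (ℤₚ.i≡j⇒i-j≡0 (sym r≡m))) (ℤₚ.*-zeroʳ m))))
    ... | z₁ , z₂ , z₃ , z₄ = divides (+ 1 + (q₁ + q₂ + q₃ + q₄) + D)
      (trans p≡ (trans (cong₂ (λ a b → a + b + m * D) r≡m 2S≡) (factor m (q₁ + q₂ + q₃ + q₄) D)))
      where
      D = q₁ * q₁ + q₂ * q₂ + q₃ * q₃ + q₄ * q₄
      factor : ∀ m s d → m + m * s + m * d ≡ (+ 1 + s + d) * m
      factor = solve-∀
      distrib : ∀ a b c d x y z w →
        + 2 * (a * x + b * y + c * z + d * w) ≡ + 2 * a * x + + 2 * b * y + + 2 * c * z + + 2 * d * w
      distrib = solve-∀
      collect : ∀ m x y z w → m * x + m * y + m * z + m * w ≡ m * (x + y + z + w)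
      collect = solve-∀
      2S≡ : + 2 * (y₁ * q₁ + y₂ * q₂ + y₃ * q₃ + y₄ * q₄) ≡ m * (q₁ + q₂ + q₃ + q₄)
      2S≡ = trans (distrib y₁ y₂ y₃ y₄ q₁ q₂ q₃ q₄) (trans (sym (cong₂ _+_ (cong₂ _+_ (cong₂ _+_
        (cong (_* q₁) (residue-extremal {m} {y₁} l₁ z₁)) (cong (_* q₂) (residue-extremal {m} {y₂} l₂ z₂)))
        (cong (_* q₃) (residue-extremal {m} {y₃} l₃ z₃))) (cong (_* q₄) (residue-extremal {m} {y₄} l₄ z₄))))
        (collect m q₁ q₂ q₃ q₄))

-- Either boundary value r = 0 or r = m would force m to divide p, which is impossible for a prime p
-- with 1 < m < p.
descent-step : ∀ {p m} .{{_ : ℕ.NonZero m}} → Prime p → 1 < m → m < p → FourSquares (+ m * + p) →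
  ∃ λ r → 0 < r × r < m × FourSquares (+ r * + p)
descent-step {p} {m} pp 1<m m<p (x₁ , x₂ , x₃ , x₄ , eq) =
  let y₁ , q₁ , e₁ , u₁ , l₁ = symmetricResidue m x₁
      y₂ , q₂ , e₂ , u₂ , l₂ = symmetricResidue m x₂
      y₃ , q₃ , e₃ , u₃ , l₃ = symmetricResidue m x₃
      y₄ , q₄ , e₄ , u₄ , l₄ = symmetricResidue m x₄
  in start y₁ y₂ y₃ y₄ q₁ q₂ q₃ q₄ u₁ u₂ u₃ u₄ l₁ l₂ l₃ l₄ e₁ e₂ e₃ e₄
  where
  restore : ∀ p s d → p ≡ p - s - d + s + d
  restore = solve-∀

  finish : ∀ y₁ y₂ y₃ y₄ q₁ q₂ q₃ q₄ →
    + 0 ℤ.≤ + m - + 2 * y₁ → + 0 ℤ.≤ + m - + 2 * y₂ → + 0 ℤ.≤ + m - + 2 * y₃ → + 0 ℤ.≤ + m - + 2 * y₄ →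
    + 0 ℤ.< + m + + 2 * y₁ → + 0 ℤ.< + m + + 2 * y₂ → + 0 ℤ.< + m + + 2 * y₃ → + 0 ℤ.< + m + + 2 * y₄ →
    ∀ r → + p ≡ r + + 2 * (y₁ * q₁ + y₂ * q₂ + y₃ * q₃ + y₄ * q₄) + + m * (q₁ * q₁ + q₂ * q₂ + q₃ * q₃ + q₄ * q₄) →
    + m * r ≡ y₁ * y₁ + y₂ * y₂ + y₃ * y₃ + y₄ * y₄ →
    ∃ λ r → 0 < r × r < m × FourSquares (+ r * + p)
  finish y₁ y₂ y₃ y₄ q₁ q₂ q₃ q₄ u₁ u₂ u₃ u₄ l₁ l₂ l₃ l₄ r p≡ mr≡ =
    ∣ r ∣ , ℕₚ.n≢0⇒n>0 (λ ∣r∣≡0 → m∤p (quotient≡0⇒∣ (+ m) (+ p) r y₁ y₂ y₃ y₄ q₁ q₂ q₃ q₄ p≡ mr≡ (ℤₚ.∣i∣≡0⇒i≡0 ∣r∣≡0))) ,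
    ℤₚ.drop‿+<+ (subst (ℤ._< + m) (sym ∣r∣≡r) (ℤₚ.≤∧≢⇒<
      (quotient≤ (+ m) (+ p) r y₁ y₂ y₃ y₄ q₁ q₂ q₃ q₄ p≡ mr≡ u₁ u₂ u₃ u₄ l₁ l₂ l₃ l₄)
      (m∤p ∘ quotient≡⇒∣ (+ m) (+ p) r y₁ y₂ y₃ y₄ q₁ q₂ q₃ q₄ p≡ mr≡ u₁ u₂ u₃ u₄ l₁ l₂ l₃ l₄))) ,
    subst (λ t → FourSquares (t * + p)) (sym ∣r∣≡r)
      (FourSquares-quotient (+ m) (+ p) r y₁ y₂ y₃ y₄ q₁ q₂ q₃ q₄ p≡ mr≡)
    where
    instance _ = ℤ.positive (+<+ (ℕₚ.<-trans ℕ.z<s 1<m))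
    m∤p = 1<m<p⇒m∤p pp 1<m m<p
    ∣r∣≡r = ℤₚ.0≤i⇒+∣i∣≡i (0≤quotient (+ m) (+ p) r y₁ y₂ y₃ y₄ q₁ q₂ q₃ q₄ p≡ mr≡)

  start : ∀ y₁ y₂ y₃ y₄ q₁ q₂ q₃ q₄ →
    + 0 ℤ.≤ + m - + 2 * y₁ → + 0 ℤ.≤ + m - + 2 * y₂ → + 0 ℤ.≤ + m - + 2 * y₃ → + 0 ℤ.≤ + m - + 2 * y₄ →
    + 0 ℤ.< + m + + 2 * y₁ → + 0 ℤ.< + m + + 2 * y₂ → + 0 ℤ.< + m + + 2 * y₃ → + 0 ℤ.< + m + + 2 * y₄ →
    x₁ ≡ y₁ + q₁ * + m → x₂ ≡ y₂ + q₂ * + m → x₃ ≡ y₃ + q₃ * + m → x₄ ≡ y₄ + q₄ * + m →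
    ∃ λ r → 0 < r × r < m × FourSquares (+ r * + p)
  start y₁ y₂ y₃ y₄ q₁ q₂ q₃ q₄ u₁ u₂ u₃ u₄ l₁ l₂ l₃ l₄ e₁ e₂ e₃ e₄ =
    finish y₁ y₂ y₃ y₄ q₁ q₂ q₃ q₄ u₁ u₂ u₃ u₄ l₁ l₂ l₃ l₄ (+ p - + 2 * S - + m * D) (restore (+ p) (+ 2 * S) (+ m * D))
      (sum-squares-mod (+ m) (+ p) y₁ y₂ y₃ y₄ q₁ q₂ q₃ q₄ (trans eq
        (cong₂ _+_ (cong₂ _+_ (cong₂ _+_ (cong (λ t → t * t) e₁) (cong (λ t → t * t) e₂))
          (cong (λ t → t * t) e₃)) (cong (λ t → t * t) e₄))))
    where
    S = y₁ * q₁ + y₂ * q₂ + y₃ * q₃ + y₄ * q₄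
    D = q₁ * q₁ + q₂ * q₂ + q₃ * q₃ + q₄ * q₄

-- Strong induction on the multiplier, which the descent step lowers while keeping it positive,
-- until it is 1.
descent : ∀ {p} → Prime p → ∀ m → 0 < m → m < p → FourSquares (+ m * + p) → FourSquares (+ p)
descent {p} pp = <-rec _ λ where
  zero            rec () _ _
  (suc zero)      rec _ _ fs → subst FourSquares (ℤₚ.*-identityˡ (+ p)) fs
  m@(suc (suc _)) rec _ m<p fs → case descent-step {m = m} pp (ℕ.s≤s (ℕ.s≤s ℕ.z≤n)) m<p fs of λ where
    (r , 0<r , r<m , fs′) → rec r<m 0<r (ℕₚ.<-trans r<m m<p) fs′

-- Solving i² + j² + 1 ≡ 0 modulo a prime.

residueClass : ∀ p .{{_ : ℕ.NonZero p}} → ℤ → Fin p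
residueClass p x = fromℕ< (n%ℕd<d x p)

residueClass-≡⇒∣ : ∀ p .{{_ : ℕ.NonZero p}} x y → residueClass p x ≡ residueClass p y → + p ∣ x - y
residueClass-≡⇒∣ p x y eq = divides (x /ℕ p - y /ℕ p) (begin
  x - y                                                     ≡⟨ cong₂ _-_ (a≡a%ℕn+[a/ℕn]*n x p) (a≡a%ℕn+[a/ℕn]*n y p) ⟩
  + (x %ℕ p) + x /ℕ p * + p - (+ (y %ℕ p) + y /ℕ p * + p)   ≡⟨ cong (λ r → + r + x /ℕ p * + p - (+ (y %ℕ p) + y /ℕ p * + p)) %≡ ⟩
  + (y %ℕ p) + x /ℕ p * + p - (+ (y %ℕ p) + y /ℕ p * + p)   ≡⟨ cancel (+ (y %ℕ p)) (x /ℕ p) (y /ℕ p) (+ p) ⟩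
  (x /ℕ p - y /ℕ p) * + p                                   ∎)
  where
  open ≡-Reasoning
  %≡ : x %ℕ p ≡ y %ℕ p
  %≡ = Finₚ.fromℕ<-injective _ _ (n%ℕd<d x p) (n%ℕd<d y p) eq
  cancel : ∀ r a b p → r + a * p - (r + b * p) ≡ (a - b) * p
  cancel = solve-∀

-- In j² - i² = (j - i)(i + j) both factors lie strictly between 0 and p, so Euclid's lemma leaves p
-- no factor to divide.
squares-incongruent : ∀ {p i j} → Prime p → i < j → i ℕ.+ j < p → ¬ + p ∣ + (i ℕ.* i) - + (j ℕ.* j)
squares-incongruent {p} {i} {j} pp i<j i+j<p p∣ =
  [ ∣-between (ℕₚ.m<n⇒0<n∸m i<j) (ℕₚ.≤-<-trans (ℕₚ.≤-trans (ℕₚ.m∸n≤m j i) (ℕₚ.m≤n+m j i)) i+j<p)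
  , ∣-between (ℕₚ.<-≤-trans (ℕₚ.≤-<-trans ℕ.z≤n i<j) (ℕₚ.m≤n+m j i)) i+j<p ]′
  (euclidsLemma (j ℕ.∸ i) (i ℕ.+ j) pp (subst (p ℕ.∣_) factor (∣⇒∣ᵤ p∣)))
  where
  open ≡-Reasoning
  factor : ∣ + (i ℕ.* i) - + (j ℕ.* j) ∣ ≡ (j ℕ.∸ i) ℕ.* (i ℕ.+ j)
  factor = begin
    ∣ + (i ℕ.* i) - + (j ℕ.* j) ∣   ≡⟨ cong ∣_∣ (ℤₚ.[+m]-[+n]≡m⊖n (i ℕ.* i) (j ℕ.* j)) ⟩
    ∣ i ℕ.* i ℤ.⊖ j ℕ.* j ∣         ≡⟨ ℤₚ.∣⊖∣-≤ (ℕₚ.*-mono-≤ (ℕₚ.<⇒≤ i<j) (ℕₚ.<⇒≤ i<j)) ⟩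
    j ℕ.* j ℕ.∸ i ℕ.* i             ≡⟨ cong (λ t → t ℕ.* t ℕ.∸ i ℕ.* i) (ℕₚ.m+[n∸m]≡n (ℕₚ.<⇒≤ i<j)) ⟨
    (i ℕ.+ d) ℕ.* (i ℕ.+ d) ℕ.∸ i ℕ.* i     ≡⟨ cong (ℕ._∸ i ℕ.* i) (expand i d) ⟩
    i ℕ.* i ℕ.+ d ℕ.* (i ℕ.+ (i ℕ.+ d)) ℕ.∸ i ℕ.* i ≡⟨ ℕₚ.m+n∸m≡n (i ℕ.* i) _ ⟩
    d ℕ.* (i ℕ.+ (i ℕ.+ d))         ≡⟨ cong (λ t → d ℕ.* (i ℕ.+ t)) (ℕₚ.m+[n∸m]≡n (ℕₚ.<⇒≤ i<j)) ⟩
    d ℕ.* (i ℕ.+ j)                 ∎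
    where
    d = j ℕ.∸ i
    expand : ∀ i d → (i ℕ.+ d) ℕ.* (i ℕ.+ d) ≡ i ℕ.* i ℕ.+ d ℕ.* (i ℕ.+ (i ℕ.+ d))
    expand = ℕ-solve-∀

∣-swap : ∀ {k} i j → k ∣ i - j → k ∣ j - i
∣-swap {k} i j (divides q eq) = divides (- q) (begin
  j - i     ≡⟨ neg-swap i j ⟩
  - (i - j) ≡⟨ cong -_ eq ⟩
  - (q * k) ≡⟨ ℤₚ.neg-distribˡ-* q k ⟩
  - q * k   ∎)
  where
  open ≡-Reasoning
  neg-swap : ∀ i j → j - i ≡ - (i - j)
  neg-swap = solve-∀

module _ {p : ℕ} (pp : Prime p) where
  private
    h = ℕ.⌊ p /2⌋

    instance _ = prime⇒nonZero pp

    -- This bound keeps i + j below p for i < j ≤ h, as the incongruence of squares requires; the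
    -- next one provides more candidates than residue classes. Both hold for p = 2 as well, so that
    -- prime needs no separate case.
    h+h≤p : h ℕ.+ h ℕ.≤ p
    h+h≤p = subst (h ℕ.+ h ℕ.≤_) (ℕₚ.⌊n/2⌋+⌈n/2⌉≡n p) (ℕₚ.+-monoʳ-≤ h (ℕₚ.⌊n/2⌋≤⌈n/2⌉ p))

    p<2+2h : p < suc h ℕ.+ suc h
    p<2+2h = ℕ.s≤s (subst (ℕ._≤ h ℕ.+ suc h) (ℕₚ.⌊n/2⌋+⌈n/2⌉≡n p)
      -- Here ⌈p/2⌉ is by definition ⌊(p + 1)/2⌋, which is at most ⌊(p + 2)/2⌋ = h + 1.
      (ℕₚ.+-monoʳ-≤ h (ℕₚ.⌊n/2⌋-mono (ℕₚ.n≤1+n (suc p)))))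

    sq : Fin (suc h) → ℤ
    sq i = + (toℕ i ℕ.* toℕ i)

    class : Fin (suc h) ⊎ Fin (suc h) → Fin p
    class (inj₁ i) = residueClass p (sq i)
    class (inj₂ j) = residueClass p (- + 1 - sq j)

    toℕ≤h : ∀ (i : Fin (suc h)) → toℕ i ℕ.≤ h
    toℕ≤h i = ℕ.s≤s⁻¹ (Finₚ.toℕ<n i)

    sq-distinct : ∀ {i j} → + p ∣ sq i - sq j → i ≡ j
    sq-distinct {i} {j} p∣ with ℕₚ.<-cmp (toℕ i) (toℕ j)
    ... | tri≈ _ i≡j _ = Finₚ.toℕ-injective i≡j
    ... | tri< i<j _ _ = contradiction p∣
      (squares-incongruent pp i<j (ℕₚ.<-≤-trans (ℕₚ.+-mono-<-≤ (ℕₚ.<-≤-trans i<j (toℕ≤h j)) (toℕ≤h j)) h+h≤p))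
    ... | tri> _ _ j<i = contradiction (∣-swap (sq i) (sq j) p∣)
      (squares-incongruent pp j<i (ℕₚ.<-≤-trans (ℕₚ.+-mono-<-≤ (ℕₚ.<-≤-trans j<i (toℕ≤h i)) (toℕ≤h i)) h+h≤p))

    Witness : Set
    Witness = ∃₂ λ i j → ∃ λ m → i ℕ.≤ h × j ℕ.≤ h × i ℕ.* i ℕ.+ j ℕ.* j ℕ.+ 1 ≡ m ℕ.* p

    witness : ∀ i j → + p ∣ sq i - (- + 1 - sq j) → Witness
    witness i j p∣ with ∣⇒∣ᵤ (subst (+ p ∣_) (regroup (sq i) (sq j)) p∣)
      where
      regroup : ∀ x y → x - (- + 1 - y) ≡ x + y + + 1
      regroup = solve-∀
    ... | ℕ.divides m eq = toℕ i , toℕ j , m , toℕ≤h i , toℕ≤h j , eq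

    collision : ∀ a b → a ≢ b → class a ≡ class b → Witness
    collision (inj₁ i) (inj₁ j) a≢b eq = contradiction (cong inj₁ (sq-distinct (residueClass-≡⇒∣ p (sq i) (sq j) eq))) a≢b
    collision (inj₂ i) (inj₂ j) a≢b eq = contradiction (cong inj₂ (sym (sq-distinct
      (subst (+ p ∣_) (cancel (sq i) (sq j)) (residueClass-≡⇒∣ p (- + 1 - sq i) (- + 1 - sq j) eq))))) a≢b
      where
      cancel : ∀ x y → - + 1 - x - (- + 1 - y) ≡ y - x
      cancel = solve-∀
    collision (inj₁ i) (inj₂ j) _ eq = witness i j (residueClass-≡⇒∣ p (sq i) (- + 1 - sq j) eq)
    collision (inj₂ j) (inj₁ i) _ eq = witness i j (residueClass-≡⇒∣ p (sq i) (- + 1 - sq j) (sym eq))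

  -- Among the p + 1 or more numbers i² and -1-j² with 0 ≤ i, j ≤ ⌊p/2⌋ two are
  -- congruent modulo p, and they cannot both be of the same kind.
  p∣i²+j²+1 : ∃₂ λ i j → ∃ λ m → i ℕ.≤ h × j ℕ.≤ h × i ℕ.* i ℕ.+ j ℕ.* j ℕ.+ 1 ≡ m ℕ.* p
  p∣i²+j²+1 with Finₚ.pigeonhole p<2+2h (class ∘ splitAt (suc h))
  ... | k , l , k<l , eq = collision (splitAt (suc h) k) (splitAt (suc h) l) split≢ eq
    where
    split≢ : splitAt (suc h) k ≢ splitAt (suc h) l
    split≢ s≡ = Finₚ.<⇒≢ k<l (trans (sym (Finₚ.join-splitAt (suc h) (suc h) k))
      (trans (cong (join (suc h) (suc h)) s≡) (Finₚ.join-splitAt (suc h) (suc h) l)))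

  -- The solution of the congruence reads mp = i² + j² + 1² + 0². Its bounds on i and j give 0 < m <
  -- p, the range in which the descent can start.
  FourSquares-prime : FourSquares (+ p)
  FourSquares-prime with p∣i²+j²+1
  ... | i , j , m , i≤h , j≤h , eq = descent pp m 0<m m<p
    (+ i , + j , + 1 , + 0 , (begin
      + m * + p                         ≡⟨ ℤₚ.pos-* m p ⟨
      + (m ℕ.* p)                       ≡⟨ cong +_ eq ⟨
      + (i ℕ.* i) + + (j ℕ.* j) + + 1   ≡⟨ cong₂ (λ a b → a + b + + 1) (ℤₚ.pos-* i i) (ℤₚ.pos-* j j) ⟩
      + i * + i + + j * + j + + 1       ≡⟨ ℤₚ.+-identityʳ _ ⟨
      + i * + i + + j * + j + + 1 + + 0 ∎))
    where
    open ≡-Reasoning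
    0<m : 0 < m
    0<m = ℕₚ.n≢0⇒n>0 λ { refl → contradiction (trans (ℕₚ.+-comm 1 _) eq) λ () }
    1<p : 1 < p
    1<p = ℕ.nonTrivial⇒n>1 p {{prime⇒nonTrivial pp}}
    -- Doubling avoids halves: 2(h² + h² + 1) = (2h)² + 2 ≤ p² + 2, and 2 < p² because p ≥ 2.
    double<p² : 2 ℕ.* (m ℕ.* p) < 2 ℕ.* (p ℕ.* p)
    double<p² = subst (λ t → 2 ℕ.* t < 2 ℕ.* (p ℕ.* p)) eq (R.begin-strict
      2 ℕ.* (i ℕ.* i ℕ.+ j ℕ.* j ℕ.+ 1)   R.≤⟨ ℕₚ.*-monoʳ-≤ 2 (ℕₚ.+-monoˡ-≤ 1 (ℕₚ.+-mono-≤ (ℕₚ.*-mono-≤ i≤h i≤h) (ℕₚ.*-mono-≤ j≤h j≤h))) ⟩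
      2 ℕ.* (h ℕ.* h ℕ.+ h ℕ.* h ℕ.+ 1)   R.≡⟨ square-double h ⟩
      (h ℕ.+ h) ℕ.* (h ℕ.+ h) ℕ.+ 2       R.≤⟨ ℕₚ.+-monoˡ-≤ 2 (ℕₚ.*-mono-≤ h+h≤p h+h≤p) ⟩
      p ℕ.* p ℕ.+ 2                       R.<⟨ ℕₚ.+-monoʳ-< (p ℕ.* p) (ℕₚ.<-≤-trans (ℕ.s≤s (ℕ.s≤s (ℕ.s≤s ℕ.z≤n))) (ℕₚ.*-mono-≤ 1<p 1<p)) ⟩
      p ℕ.* p ℕ.+ p ℕ.* p                 R.≡⟨ cong (p ℕ.* p ℕ.+_) (ℕₚ.+-identityʳ (p ℕ.* p)) ⟨
      2 ℕ.* (p ℕ.* p)                     R.∎)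
      where
      module R = ℕₚ.≤-Reasoning
      square-double : ∀ h → 2 ℕ.* (h ℕ.* h ℕ.+ h ℕ.* h ℕ.+ 1) ≡ (h ℕ.+ h) ℕ.* (h ℕ.+ h) ℕ.+ 2
      square-double = ℕ-solve-∀
    m<p : m < p
    m<p = ℕₚ.*-cancelʳ-< p m p (ℕₚ.*-cancelˡ-< 2 _ _ double<p²)

-- By Euler's identity sums of four squares are closed under products, so the prime factors suffice.
lagrange : ∀ n → FourSquares (+ n)
lagrange zero      = + 0 , + 0 , + 0 , + 0 , refl
lagrange n@(suc _) = subst (FourSquares ∘ +_) (sym isFactorisation) (FourSquares-product factorsPrime)
  where
  open PrimeFactorisation (factorise n)
  FourSquares-product : ∀ {ps} → All Prime ps → FourSquares (+ product ps)
  FourSquares-product []         = + 1 , + 0 , + 0 , + 0 , refl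
  FourSquares-product {p ∷ ps} (pp ∷ pps) = subst FourSquares (sym (ℤₚ.pos-* p (product ps)))
    (FourSquares-* (FourSquares-prime pp) (FourSquares-product pps))

-- Finite sums of integers.

sumFin-cong : ∀ k {f g : Fin k → ℤ} → (∀ i → f i ≡ g i) → sumFin k f ≡ sumFin k g
sumFin-cong zero    f≡g = refl
sumFin-cong (suc k) f≡g = cong₂ _+_ (f≡g zero) (sumFin-cong k (f≡g ∘ suc))

sumFin-+ : ∀ k (f g : Fin k → ℤ) → sumFin k (λ i → f i + g i) ≡ sumFin k f + sumFin k g
sumFin-+ zero    f g = refl
sumFin-+ (suc k) f g = trans (cong (_+_ (f zero + g zero)) (sumFin-+ k (f ∘ suc) (g ∘ suc)))
  (interchange (f zero) (g zero) (sumFin k (f ∘ suc)) (sumFin k (g ∘ suc)))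
  where
  interchange : ∀ a b c d → a + b + (c + d) ≡ a + c + (b + d)
  interchange = solve-∀

sumFin-*ʳ : ∀ k (f : Fin k → ℤ) c → sumFin k (λ i → f i * c) ≡ sumFin k f * c
sumFin-*ʳ zero    f c = refl
sumFin-*ʳ (suc k) f c = trans (cong (_+_ (f zero * c)) (sumFin-*ʳ k (f ∘ suc) c))
  (sym (ℤₚ.*-distribʳ-+ c (f zero) (sumFin k (f ∘ suc))))

sumFin-const : ∀ k c → sumFin k (λ _ → c) ≡ + k * c
sumFin-const zero    c = refl
sumFin-const (suc k) c = trans (cong (_+_ c) (sumFin-const k c)) (sym (ℤₚ.suc-* (+ k) c))

sumFin-↑ : ∀ m n (f : Fin (m ℕ.+ n) → ℤ) →
  sumFin (m ℕ.+ n) f ≡ sumFin m (λ i → f (i ↑ˡ n)) + sumFin n (λ j → f (m ↑ʳ j))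
sumFin-↑ zero    n f = sym (ℤₚ.+-identityˡ _)
sumFin-↑ (suc m) n f = trans (cong (_+_ (f zero)) (sumFin-↑ m n (f ∘ suc)))
  (sym (ℤₚ.+-assoc (f zero) _ _))

sumFin-mono : ∀ k {f g : Fin k → ℤ} → (∀ i → f i ℤ.≤ g i) → sumFin k f ℤ.≤ sumFin k g
sumFin-mono zero    f≤g = ℤₚ.≤-refl
sumFin-mono (suc k) f≤g = ℤₚ.+-mono-≤ (f≤g zero) (sumFin-mono k (f≤g ∘ suc))

0≤sumFin : ∀ k {f : Fin k → ℤ} → (∀ i → + 0 ℤ.≤ f i) → + 0 ℤ.≤ sumFin k f
0≤sumFin zero    0≤f = ℤₚ.≤-refl
0≤sumFin (suc k) 0≤f = 0≤+ (0≤f zero) (0≤sumFin k (0≤f ∘ suc))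

i≤i+j : ∀ {i j} → + 0 ℤ.≤ j → i ℤ.≤ i + j
i≤i+j {i} {j} 0≤j = subst (ℤ._≤ i + j) (ℤₚ.+-identityʳ i) (ℤₚ.+-monoʳ-≤ i 0≤j)

j≤i+j : ∀ {i j} → + 0 ℤ.≤ i → j ℤ.≤ i + j
j≤i+j {i} {j} 0≤i = subst (j ℤ.≤_) (ℤₚ.+-comm j i) (i≤i+j 0≤i)

term≤sumFin : ∀ k {f : Fin k → ℤ} → (∀ i → + 0 ℤ.≤ f i) → ∀ i → f i ℤ.≤ sumFin k f
term≤sumFin (suc k) 0≤f zero    = i≤i+j (0≤sumFin k (0≤f ∘ suc))
term≤sumFin (suc k) 0≤f (suc i) = ℤₚ.≤-trans (term≤sumFin k (0≤f ∘ suc) i) (j≤i+j (0≤f zero))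

-- Triangular sums whose only cross terms join the first variable to the others

-- Only the first row can contribute, and there the test `i <? j` evaluates to false on the diagonal
-- and to true everywhere else.
sumPairs-star : ∀ k (g : Fin (suc k) → Fin (suc k) → ℤ) → (∀ i j → g (suc i) j ≡ + 0) →
  sumPairs (suc k) g ≡ sumFin k (λ j → g zero (suc j))
sumPairs-star k g g≡0 = begin
  sumPairs (suc k) g              ≡⟨ cong₂ _+_ (ℤₚ.+-identityˡ row) (trans
                                       (sumFin-cong k (λ i → sumFin≡0 (suc k) (λ j → if≡0 ⌊ suc i Fin.<? j ⌋ (g≡0 i j)))) (sumFin≡0 k (λ _ → refl))) ⟩
  row + + 0                       ≡⟨ ℤₚ.+-identityʳ row ⟩
  row                             ∎
  where
  open ≡-Reasoning
  row = sumFin k (λ j → g zero (suc j))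
  if≡0 : ∀ b {z} → z ≡ + 0 → (if b then z else + 0) ≡ + 0
  if≡0 true  z≡0 = z≡0
  if≡0 false _   = refl
  sumFin≡0 : ∀ k {f : Fin k → ℤ} → (∀ i → f i ≡ + 0) → sumFin k f ≡ + 0
  sumFin≡0 k f≡0 = trans (sumFin-cong k f≡0) (trans (sumFin-const k (+ 0)) (ℤₚ.*-zeroʳ (+ k)))

0≤twoT : ∀ x → + 0 ℤ.≤ twoT x
0≤twoT (+ n)          = 0≤* {+ n} {+ (n ℕ.+ 1)} (+≤+ ℕ.z≤n) (+≤+ ℕ.z≤n)
0≤twoT -[1+ zero ]    = +≤+ ℕ.z≤n
0≤twoT -[1+ suc n ]   = +≤+ ℕ.z≤n

-- The gap between 0 and the next value 2 of x(x + 1) is what lets a small value of f confine its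
-- variables.
twoT-cases : ∀ x → (x ≡ + 0 ⊎ x ≡ - + 1) ⊎ + 2 ℤ.≤ twoT x
twoT-cases (+ zero)      = inj₁ (inj₁ refl)
twoT-cases (+ suc n)     = inj₂ (+≤+ (ℕₚ.*-mono-≤ {1} {suc n} {2} (ℕ.s≤s ℕ.z≤n) (ℕ.s≤s (ℕₚ.m≤n+m 1 n))))
twoT-cases -[1+ zero ]   = inj₁ (inj₂ refl)
twoT-cases -[1+ suc n ]  = inj₂ (+≤+ (ℕₚ.*-mono-≤ {2} {suc (suc n)} {1} (ℕ.s≤s (ℕ.s≤s ℕ.z≤n)) (ℕ.s≤s ℕ.z≤n)))

module Star (ℓ : ℕ) (b₀ : ℤ) (b γ : Fin ℓ → ℤ) where

  -- Since 4X₀Xⱼ = 2(X₀ + Xⱼ)² - 2X₀² - 2Xⱼ², these a are what completing the squares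
  -- in Q and in f turns into b₀ and b; the constant left over in f is -Σγ.
  a : Fin (suc ℓ) → ℤ
  a zero    = b₀ + + 2 * sumFin ℓ γ
  a (suc j) = b j + + 2 * γ j

  c : Fin (suc ℓ) → Fin (suc ℓ) → ℤ
  c zero    zero    = + 0
  c zero    (suc j) = γ j
  c (suc i) j       = + 0

  C : ℤ
  C = sumFin ℓ γ

  -- Each completed square uses up 2γⱼx₀², in total the 2Γx₀² by which `a zero` exceeds `b₀`. In
  -- this shape positivity can be read off term by term.
  Q-star : ∀ x → Q (suc ℓ) a c x ≡
    b₀ * (x zero * x zero) +
    sumFin ℓ (λ j → b j * (x (suc j) * x (suc j)) + + 2 * γ j * ((x zero + x (suc j)) * (x zero + x (suc j))))
  Q-star x = begin
    (b₀ + + 2 * Γ) * (x₀ * x₀) + diagonal + sumPairs (suc ℓ) (λ i j → + 4 * c i j * (x i * x j))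
      ≡⟨ cong (_+_ ((b₀ + + 2 * Γ) * (x₀ * x₀) + diagonal)) (sumPairs-star ℓ (λ i j → + 4 * c i j * (x i * x j)) (λ _ _ → refl)) ⟩
    (b₀ + + 2 * Γ) * (x₀ * x₀) + diagonal + cross
      ≡⟨ regroup b₀ Γ (x₀ * x₀) diagonal cross ⟩
    b₀ * (x₀ * x₀) + (diagonal + cross + Γ * (+ 2 * (x₀ * x₀)))
      ≡⟨ cong (_+_ (b₀ * (x₀ * x₀))) sum≡ ⟨
    _ ∎
    where
    open ≡-Reasoning
    Γ = sumFin ℓ γ
    x₀ = x zero
    diagonal = sumFin ℓ (λ j → (b j + + 2 * γ j) * (x (suc j) * x (suc j)))
    cross = sumFin ℓ (λ j → + 4 * γ j * (x₀ * x (suc j)))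
    regroup : ∀ b Γ t d e → (b + + 2 * Γ) * t + d + e ≡ b * t + (d + e + Γ * (+ 2 * t))
    regroup = solve-∀
    square : ∀ b γ x y → b * (y * y) + + 2 * γ * ((x + y) * (x + y)) ≡
      (b + + 2 * γ) * (y * y) + + 4 * γ * (x * y) + γ * (+ 2 * (x * x))
    square = solve-∀
    sum≡ = trans (sumFin-cong ℓ (λ j → square (b j) (γ j) x₀ (x (suc j))))
      (trans (sumFin-+ ℓ _ _) (cong₂ _+_ (sumFin-+ ℓ _ _) (sumFin-*ʳ ℓ γ (+ 2 * (x₀ * x₀)))))

  -- The analogue for f rests on (x + y + 1)² = x(x + 1) + y(y + 1) + (2xy + x + y) + 1; the final
  -- ones, weighted by 2γⱼ, add up to 2C.
  twiceF-star : ∀ x → twiceF (suc ℓ) a c C x ≡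
    b₀ * twoT (x zero) +
    sumFin ℓ (λ j → b j * twoT (x (suc j)) + + 2 * γ j * ((x zero + x (suc j) + + 1) * (x zero + x (suc j) + + 1)))
  twiceF-star x = begin
    (b₀ + + 2 * Γ) * twoT x₀ + diagonal + sumPairs (suc ℓ) (λ i j → c i j * twoFourB (x i) (x j)) + + 2 * Γ
      ≡⟨ cong (λ t → (b₀ + + 2 * Γ) * twoT x₀ + diagonal + t + + 2 * Γ) (sumPairs-star ℓ (λ i j → c i j * twoFourB (x i) (x j)) (λ _ _ → refl)) ⟩
    (b₀ + + 2 * Γ) * twoT x₀ + diagonal + cross + + 2 * Γ
      ≡⟨ regroup b₀ Γ (twoT x₀) diagonal cross ⟩
    b₀ * twoT x₀ + (diagonal + cross + Γ * (+ 2 * twoT x₀ + + 2))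
      ≡⟨ cong (_+_ (b₀ * twoT x₀)) sum≡ ⟨
    _ ∎
    where
    open ≡-Reasoning
    Γ = sumFin ℓ γ
    x₀ = x zero
    diagonal = sumFin ℓ (λ j → (b j + + 2 * γ j) * twoT (x (suc j)))
    cross = sumFin ℓ (λ j → γ j * twoFourB x₀ (x (suc j)))
    regroup : ∀ b Γ t d e → (b + + 2 * Γ) * t + d + e + + 2 * Γ ≡ b * t + (d + e + Γ * (+ 2 * t + + 2))
    regroup = solve-∀
    square : ∀ b γ x y → b * (y * (y + + 1)) + + 2 * γ * ((x + y + + 1) * (x + y + + 1)) ≡
      (b + + 2 * γ) * (y * (y + + 1)) + γ * (+ 2 * (+ 2 * (x * y) + x + y)) + γ * (+ 2 * (x * (x + + 1)) + + 2)
    square = solve-∀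
    sum≡ = trans (sumFin-cong ℓ (λ j → square (b j) (γ j) x₀ (x (suc j))))
      (trans (sumFin-+ ℓ _ _) (cong₂ _+_ (sumFin-+ ℓ _ _) (sumFin-*ʳ ℓ γ (+ 2 * twoT x₀ + + 2))))

  module _ (0<b₀ : + 0 ℤ.< b₀) (0<b : ∀ j → + 0 ℤ.< b j) (0≤γ : ∀ j → + 0 ℤ.≤ γ j) where

    -- Left general in t and s to serve both Q, with t = xⱼ² and s = x₀ + xⱼ, and f, with t = xⱼ(xⱼ
    -- + 1) and s = x₀ + xⱼ + 1.
    0≤term : ∀ {t} s j → + 0 ℤ.≤ t → + 0 ℤ.≤ b j * t + + 2 * γ j * (s * s)
    0≤term s j 0≤t = 0≤+ (0≤* (ℤₚ.<⇒≤ (0<b j)) 0≤t) (0≤* (0≤* {+ 2} (+≤+ ℕ.z≤n) (0≤γ j)) (0≤i*i s))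

    0≤twiceF : ∀ x → + 0 ℤ.≤ twiceF (suc ℓ) a c C x
    0≤twiceF x = subst (+ 0 ℤ.≤_) (sym (twiceF-star x))
      (0≤+ (0≤* (ℤₚ.<⇒≤ 0<b₀) (0≤twoT (x zero)))
           (0≤sumFin ℓ (λ j → 0≤term (x zero + x (suc j) + + 1) j (0≤twoT (x (suc j))))))

    -- The hypothesis is a negated universal and supplies no nonzero coordinate, so the sign of Q is
    -- decided first. If Q ≤ 0, each nonnegative summand is at most 0, which forces every coordinate
    -- to vanish.
    posDef-star : PosDef (suc ℓ) a c
    posDef-star x x≢0 with + 0 ℤ.<? Q (suc ℓ) a c x
    ... | yes 0<Q = 0<Q
    ... | no ¬0<Q = contradiction x≡0 x≢0
      where
      B : Fin ℓ → ℤ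
      B j = b j * (x (suc j) * x (suc j))
      A : Fin ℓ → ℤ
      A j = B j + + 2 * γ j * ((x zero + x (suc j)) * (x zero + x (suc j)))

      0≤A : ∀ j → + 0 ℤ.≤ A j
      0≤A j = 0≤term (x zero + x (suc j)) j (0≤i*i (x (suc j)))

      sum≤0 : b₀ * (x zero * x zero) + sumFin ℓ A ℤ.≤ + 0
      sum≤0 = subst (ℤ._≤ + 0) (Q-star x) (ℤₚ.≮⇒≥ ¬0<Q)

      b*i²≤0⇒i≡0 : ∀ {b} i → + 0 ℤ.< b → b * (i * i) ℤ.≤ + 0 → i ≡ + 0
      b*i²≤0⇒i≡0 {b} i 0<b ≤0 with ℤₚ.i*j≡0⇒i≡0∨j≡0 b (ℤₚ.≤-antisym ≤0 (0≤* (ℤₚ.<⇒≤ 0<b) (0≤i*i i)))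
      ... | inj₁ b≡0 = contradiction (sym b≡0) (ℤₚ.<⇒≢ 0<b)
      ... | inj₂ i²≡0 = i*i≡0⇒i≡0 i i²≡0

      x≡0 : ∀ i → x i ≡ + 0
      x≡0 zero    = b*i²≤0⇒i≡0 (x zero) 0<b₀ (ℤₚ.≤-trans (i≤i+j (0≤sumFin ℓ 0≤A)) sum≤0)
      x≡0 (suc j) = b*i²≤0⇒i≡0 (x (suc j)) (0<b j) (ℤₚ.≤-trans
        (i≤i+j (0≤* (0≤* {+ 2} (+≤+ ℕ.z≤n) (0≤γ j)) (0≤i*i (x zero + x (suc j)))))
        (ℤₚ.≤-trans (term≤sumFin ℓ 0≤A j) (ℤₚ.≤-trans
          (j≤i+j (0≤* (ℤₚ.<⇒≤ 0<b₀) (0≤i*i (x zero)))) sum≤0)))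

    -- Below 2 min(b₀, b) all the triangular terms vanish, which leaves only variables in {0, -1}.
    small-twiceF≤2Σγ : ∀ {B} → B ℤ.≤ b₀ → (∀ j → B ℤ.≤ b j) → ∀ x → twiceF (suc ℓ) a c C x ℤ.< B * + 2 →
      twiceF (suc ℓ) a c C x ℤ.≤ sumFin ℓ (λ j → γ j * + 2)
    small-twiceF≤2Σγ {B} B≤b₀ B≤b x small = subst₂ ℤ._≤_ (sym (twiceF-star x)) (ℤₚ.+-identityˡ _)
      (ℤₚ.+-mono-≤ (ℤₚ.≤-reflexive b₀t₀≡0) (sumFin-mono ℓ A≤))
      where
      t₀ = twoT (x zero)
      s : Fin ℓ → ℤ
      s j = x zero + x (suc j) + + 1
      A : Fin ℓ → ℤ
      A j = b j * twoT (x (suc j)) + + 2 * γ j * (s j * s j)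

      0≤A : ∀ j → + 0 ℤ.≤ A j
      0≤A j = 0≤term (s j) j (0≤twoT (x (suc j)))

      -- Outside {0, -1} this one summand would already be at least 2d ≥ 2B, contrary to the assumed
      -- bound on the value.
      small-term : ∀ {d} y → + 0 ℤ.< d → B ℤ.≤ d → d * twoT y ℤ.≤ b₀ * t₀ + sumFin ℓ A → y ≡ + 0 ⊎ y ≡ - + 1
      small-term {d} y 0<d B≤d ≤F with twoT-cases y
      ... | inj₁ y≡ = y≡
      ... | inj₂ 2≤t = contradiction (subst (ℤ._< B * + 2) (twiceF-star x) small)
        (ℤₚ.≤⇒≯ (ℤₚ.≤-trans (ℤₚ.*-monoʳ-≤-nonNeg (+ 2) B≤d)
          (ℤₚ.≤-trans (ℤₚ.*-monoˡ-≤-nonNeg d {{ℤ.nonNegative (ℤₚ.<⇒≤ 0<d)}} 2≤t) ≤F)))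

      x₀≡ : x zero ≡ + 0 ⊎ x zero ≡ - + 1
      x₀≡ = small-term (x zero) 0<b₀ B≤b₀ (i≤i+j (0≤sumFin ℓ 0≤A))

      xⱼ≡ : ∀ j → x (suc j) ≡ + 0 ⊎ x (suc j) ≡ - + 1
      xⱼ≡ j = small-term (x (suc j)) (0<b j) (B≤b j) (ℤₚ.≤-trans
        (i≤i+j (0≤* (0≤* {+ 2} (+≤+ ℕ.z≤n) (0≤γ j)) (0≤i*i (s j))))
        (ℤₚ.≤-trans (term≤sumFin ℓ 0≤A j) (j≤i+j (0≤* (ℤₚ.<⇒≤ 0<b₀) (0≤twoT (x zero))))))

      d*twoT≡0 : ∀ {y} d → y ≡ + 0 ⊎ y ≡ - + 1 → d * twoT y ≡ + 0
      d*twoT≡0 d (inj₁ refl) = ℤₚ.*-zeroʳ d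
      d*twoT≡0 d (inj₂ refl) = ℤₚ.*-zeroʳ d

      b₀t₀≡0 : b₀ * t₀ ≡ + 0
      b₀t₀≡0 = d*twoT≡0 b₀ x₀≡

      -- For such x and y the base x + y + 1 is 1, 0 or -1.
      square≤1 : ∀ {x y} → x ≡ + 0 ⊎ x ≡ - + 1 → y ≡ + 0 ⊎ y ≡ - + 1 → (x + y + + 1) * (x + y + + 1) ℤ.≤ + 1
      square≤1 (inj₁ refl) (inj₁ refl) = ℤₚ.≤-refl
      square≤1 (inj₁ refl) (inj₂ refl) = +≤+ ℕ.z≤n
      square≤1 (inj₂ refl) (inj₁ refl) = +≤+ ℕ.z≤n
      square≤1 (inj₂ refl) (inj₂ refl) = ℤₚ.≤-refl

      A≤ : ∀ j → A j ℤ.≤ γ j * + 2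
      A≤ j = subst₂ ℤ._≤_
        (sym (trans (cong (_+ + 2 * γ j * (s j * s j)) (d*twoT≡0 (b j) (xⱼ≡ j))) (ℤₚ.+-identityˡ _)))
        (trans (ℤₚ.*-identityʳ (+ 2 * γ j)) (ℤₚ.*-comm (+ 2) (γ j)))
        (ℤₚ.*-monoˡ-≤-nonNeg (+ 2 * γ j) {{ℤ.nonNegative (0≤* {+ 2} (+≤+ ℕ.z≤n) (0≤γ j))}} (square≤1 x₀≡ (xⱼ≡ j)))

-- The triangular sum that misses exactly m + 1.

module _ (m : ℕ) where
  private
    N : ℕ
    N = suc (suc m)

    γ : Fin (m ℕ.+ 8) → ℤ
    γ = replicate m (+ 1) ++ replicate 8 (+ 0)

    0≤γ : ∀ j → + 0 ℤ.≤ γ j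
    0≤γ j with splitAt m j
    ... | inj₁ _ = +≤+ ℕ.z≤n
    ... | inj₂ _ = +≤+ ℕ.z≤n

    b : Fin (m ℕ.+ 8) → ℤ
    b _ = + N

    -- The first coefficient is N + 1 and not N: at x₀ = 1 its excess moves the largest leaf residue
    -- m to m + 1, the only residue modulo N that the leaves do not reach at x₀ = 0.
    open Star (m ℕ.+ 8) (+ suc N) b γ

    F : (Fin (suc (m ℕ.+ 8)) → ℤ) → ℤ
    F = twiceF (suc (m ℕ.+ 8)) a c C

    -- twice the contribution of a variable y with γ = 1 when the first variable is x
    leaf : ℤ → ℤ → ℤ
    leaf x y = + N * twoT y + + 2 * + 1 * ((x + y + + 1) * (x + y + + 1))

    F-split : ∀ x u v → F (x ∷ᵛ (u ++ v)) ≡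
      + suc N * twoT x + (sumFin m (λ i → leaf x (u i)) + sumFin 8 (λ j → twoT (v j)) * + N)
    F-split x u v = trans (twiceF-star (x ∷ᵛ (u ++ v))) (cong (_+_ (+ suc N * twoT x))
      (trans (sumFin-↑ m 8 term) (cong₂ _+_
        (sumFin-cong m λ i → cong₂ (term′) (lookup-++ˡ (replicate m (+ 1)) (replicate 8 (+ 0)) i) (lookup-++ˡ u v i))
        (trans (sumFin-cong 8 λ j → trans
            (cong₂ term′ (lookup-++ʳ (replicate m (+ 1)) (replicate 8 (+ 0)) j) (lookup-++ʳ u v j))
            (trans (ℤₚ.+-identityʳ (+ N * twoT (v j))) (ℤₚ.*-comm (+ N) (twoT (v j)))))
          (sumFin-*ʳ 8 (λ j → twoT (v j)) (+ N))))))
      where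
      term′ : ℤ → ℤ → ℤ
      term′ g y = + N * twoT y + + 2 * g * ((x + y + + 1) * (x + y + + 1))
      term : Fin (m ℕ.+ 8) → ℤ
      term j = term′ (γ j) ((u ++ v) j)

    F-value : ∀ x u v {s t} → sumFin m (λ i → leaf x (u i)) ≡ s → sumFin 8 (λ j → twoT (v j)) ≡ t →
      F (x ∷ᵛ (u ++ v)) ≡ + suc N * twoT x + (s + t * + N)
    F-value x u v refl refl = F-split x u v

    -- With x₀ = 0 a leaf contributes 0 at -1 and 1 at 0, so r leaves are set to 0 and the others to
    -- -1.
    leaves : ∀ k r → r ℕ.≤ k → ∃ λ u → sumFin k (λ i → leaf (+ 0) (u i)) ≡ + 2 * + r
    leaves k zero _ = (λ _ → - + 1) , (begin
      sumFin k (λ _ → leaf (+ 0) (- + 1))  ≡⟨ sumFin-const k (leaf (+ 0) (- + 1)) ⟩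
      + k * leaf (+ 0) (- + 1)             ≡⟨ cong (λ t → + k * (t + + 0)) (ℤₚ.*-zeroʳ (+ N)) ⟩
      + k * + 0                            ≡⟨ ℤₚ.*-zeroʳ (+ k) ⟩
      + 0                                  ∎)
      where open ≡-Reasoning
    leaves (suc k) (suc r) (ℕ.s≤s r≤k) with leaves k r r≤k
    ... | u , eq = + 0 ∷ᵛ u , (begin
      leaf (+ 0) (+ 0) + sumFin k (λ i → leaf (+ 0) (u i)) ≡⟨ cong₂ _+_ (cong (_+ + 2) (ℤₚ.*-zeroʳ (+ N))) eq ⟩
      + 2 + + 2 * + r                                      ≡⟨ ℤₚ.*-distribˡ-+ (+ 2) (+ 1) (+ r) ⟨
      + 2 * + suc r                                        ∎)
      where open ≡-Reasoning

    -- T_a + T_{a-1} = a²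
    eight-triangular : ∀ q → ∃ λ v → sumFin 8 (λ j → twoT (v j)) ≡ + 2 * + q
    eight-triangular q with lagrange q
    ... | w , x , y , z , eq =
      w ∷ᵛ w - + 1 ∷ᵛ x ∷ᵛ x - + 1 ∷ᵛ y ∷ᵛ y - + 1 ∷ᵛ z ∷ᵛ z - + 1 ∷ᵛ []ᵛ ,
      trans (squares w x y z) (cong (+ 2 *_) (sym eq))
      where
      squares : ∀ w x y z →
        w * (w + + 1) + ((w - + 1) * (w - + 1 + + 1) + (x * (x + + 1) + ((x - + 1) * (x - + 1 + + 1) +
        (y * (y + + 1) + ((y - + 1) * (y - + 1 + + 1) + (z * (z + + 1) + ((z - + 1) * (z - + 1 + + 1) + + 0)))))))
        ≡ + 2 * (w * w + x * x + y * y + z * z)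
      squares = solve-∀

    represents-small-residue : ∀ r q → r ℕ.≤ m → ∃ λ x → F x ≡ + 2 * + (r ℕ.+ q ℕ.* N)
    represents-small-residue r q r≤m with leaves m r r≤m | eight-triangular q
    ... | u , u≡ | v , v≡ = + 0 ∷ᵛ (u ++ v) , (begin
      F (+ 0 ∷ᵛ (u ++ v))                             ≡⟨ F-value (+ 0) u v u≡ v≡ ⟩
      + suc N * + 0 + (+ 2 * + r + + 2 * + q * + N)   ≡⟨ cong (_+ (+ 2 * + r + + 2 * + q * + N)) (ℤₚ.*-zeroʳ (+ suc N)) ⟩
      + 0 + (+ 2 * + r + + 2 * + q * + N)             ≡⟨ collect (+ r) (+ q) (+ N) ⟩
      + 2 * (+ r + + q * + N)                         ≡⟨ cong (λ t → + 2 * (+ r + t)) (ℤₚ.pos-* q N) ⟨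
      + 2 * + (r ℕ.+ q ℕ.* N)                         ∎)
      where
      open ≡-Reasoning
      collect : ∀ r q N → + 0 + (+ 2 * r + + 2 * q * N) ≡ + 2 * (r + q * N)
      collect = solve-∀

    -- The values 2m + 3 + qN, from x₀ = 1 and all m leaves at -1.
    represents-last-residue : ∀ q → ∃ λ x → F x ≡ + 2 * + (suc m ℕ.+ suc q ℕ.* N)
    represents-last-residue q with eight-triangular q
    ... | v , v≡ = + 1 ∷ᵛ (replicate m (- + 1) ++ v) , (begin
      F (+ 1 ∷ᵛ (replicate m (- + 1) ++ v))           ≡⟨ F-value (+ 1) (replicate m (- + 1)) v
                                                           (trans (sumFin-const m (leaf (+ 1) (- + 1))) (cong (λ t → + m * (t + + 2)) (ℤₚ.*-zeroʳ (+ N)))) v≡ ⟩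
      + suc N * + 2 + (+ m * + 2 + + 2 * + q * + N)   ≡⟨ collect (+ m) (+ q) ⟩
      + 2 * (+ 1 + + m + (+ 1 + + q) * (+ 2 + + m))   ≡⟨ cong (λ t → + 2 * (+ 1 + + m + t)) (ℤₚ.pos-* (suc q) N) ⟨
      + 2 * + (suc m ℕ.+ suc q ℕ.* N)                 ∎)
      where
      open ≡-Reasoning
      collect : ∀ m q → (+ 3 + m) * + 2 + (m * + 2 + + 2 * q * (+ 2 + m)) ≡ + 2 * (+ 1 + m + (+ 1 + q) * (+ 2 + m))
      collect = solve-∀

    -- Division by N = m + 2 leaves a remainder that is either at most m or equal to m + 1, and each
    -- kind has its own construction.
    represents : ∀ n → n ≢ suc m → ∃ λ x → F x ≡ + 2 * + n
    represents n n≢ = subst (λ n → ∃ λ x → F x ≡ + 2 * + n) (sym (ℕ.m≡m%n+[m/n]*n n N))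
      (from (n ℕ.% N) (n ℕ./ N) (ℕ.m%n<n n N) (n≢ ∘ trans (ℕ.m≡m%n+[m/n]*n n N)))
      where
      from : ∀ r q → r < N → r ℕ.+ q ℕ.* N ≢ suc m → ∃ λ x → F x ≡ + 2 * + (r ℕ.+ q ℕ.* N)
      from r q r<N ≢ with r ℕ.≤? m
      ... | yes r≤m = represents-small-residue r q r≤m
      -- Remainder m + 1 with quotient 0 is the excluded number itself.
      from r zero r<N ≢ | no r≰m =
        contradiction (trans (ℕₚ.+-identityʳ r) (ℕₚ.≤-antisym (ℕ.s≤s⁻¹ r<N) (ℕₚ.≰⇒> r≰m))) ≢
      from r (suc q) r<N ≢ | no r≰m = subst (λ r → ∃ λ x → F x ≡ + 2 * + (r ℕ.+ suc q ℕ.* N))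
        (ℕₚ.≤-antisym (ℕₚ.≰⇒> r≰m) (ℕ.s≤s⁻¹ r<N)) (represents-last-residue q)

    0<N : + 0 ℤ.< + N
    0<N = +<+ ℕ.z<s

    Σγ : sumFin (m ℕ.+ 8) (λ j → γ j * + 2) ≡ + m * + 2
    Σγ = begin
      sumFin (m ℕ.+ 8) (λ j → γ j * + 2)  ≡⟨ sumFin-*ʳ (m ℕ.+ 8) γ (+ 2) ⟩
      sumFin (m ℕ.+ 8) γ * + 2            ≡⟨ cong (_* + 2) (begin
        sumFin (m ℕ.+ 8) γ                ≡⟨ sumFin-↑ m 8 γ ⟩
        _                                 ≡⟨ cong₂ _+_ (trans (sumFin-cong m (lookup-++ˡ (replicate m (+ 1)) (replicate 8 (+ 0)))) (sumFin-const m (+ 1)))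
                                                       (sumFin-cong 8 (lookup-++ʳ (replicate m (+ 1)) (replicate 8 (+ 0)))) ⟩
        + m * + 1 + + 0                   ≡⟨ trans (ℤₚ.+-identityʳ _) (ℤₚ.*-identityʳ (+ m)) ⟩
        + m                               ∎) ⟩
      + m * + 2                           ∎
      where open ≡-Reasoning

    -- As m + 1 < N, such a value would be small enough for all triangular terms to vanish, and then
    -- the leaves bound it by m.
    misses : ¬ ∃ λ x → F x ≡ + 2 * + suc m
    misses (x , eq) = contradiction
      (subst₂ ℤ._≤_ F≡ Σγ (small-twiceF≤2Σγ (+<+ ℕ.z<s) (λ _ → 0<N) 0≤γ (+≤+ (ℕₚ.n≤1+n N)) (λ _ → ℤₚ.≤-refl) x
        (subst (ℤ._< + N * + 2) (sym F≡) (ℤₚ.*-monoʳ-<-pos (+ 2) (+<+ (ℕₚ.n<1+n (suc m)))))))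
      (ℤₚ.<⇒≱ (ℤₚ.*-monoʳ-<-pos (+ 2) (+<+ (ℕₚ.n<1+n m))))
      where
      F≡ : F x ≡ + suc m * + 2
      F≡ = trans eq (ℤₚ.*-comm (+ 2) (+ suc m))

  exceptOne : Σ TriSum λ f → (∀ n → n ≢ suc m → TriSumRepresents f n) × ¬ TriSumRepresents f (suc m)
  exceptOne = record
    { k          = suc (m ℕ.+ 8)
    ; k≥1        = ℕ.s≤s ℕ.z≤n
    ; a          = a
    ; c          = c
    ; C          = C
    ; posDef     = posDef-star (+<+ ℕ.z<s) (λ _ → 0<N) 0≤γ
    -- The minimum 0 is attained because 0 differs from m + 1.
    ; normalized = 0≤twiceF (+<+ ℕ.z<s) (λ _ → 0<N) 0≤γ , represents 0 (λ ())
    } , represents , misses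

theorem1p5 : (Z : ℕ → Set) → (∀ n → Z n → 0 < n) →
    (Y : ℕ → Set) → (∀ n → Y n → Z n) → ∃ (λ z → Z z × ¬ Y z) →
    Σ TriSum (λ f → (∀ n → Y n → TriSumRepresents f n) ×
    ¬ (∀ n → Z n → TriSumRepresents f n))
theorem1p5 Z Z-pos Y Y⊆Z (zero , Zz , ¬Yz)  = contradiction (Z-pos 0 Zz) λ ()
-- The single missed number is the given element of `Z` outside `Y`, so all of `Y` is represented,
-- whatever its size.
theorem1p5 Z Z-pos Y Y⊆Z (suc m , Zz , ¬Yz) with exceptOne m
... | f , represents , misses =
  f , (λ n Yn → represents n λ { refl → ¬Yz Yn }) , (λ all → misses (all (suc m) Zz))
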